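{- For every integer $n\ge 0$, $$B_{n+1}\!\left(t+\frac{1}{t}\right)=\sum_{i=0}^{n}t^{\nu(n-i)-\nu(i)}.$$
   Context: The Stern polynomials $B_n(t)\in\mathbb{Z}[t]$, $n\ge 0$, are defined by $B_0(t)=0$, $B_1(t)=1$, $B_{2n}(t)=tB_n(t)$ and $B_{2n+1}(t)=B_n(t)+B_{n+1}(t)$ for $n\ge 1$. For $n\ge 0$, $\nu(n)$ denotes the number of digits $1$ in the binary representation of $n$. -}

module Defs where

open import Data.Bool.Base using (if_then_else_)
open import Data.Digit using (1b; toDigits)
open import Data.Fin.Properties using () renaming (_≟_ to _≟ᶠ_)
open import Data.Integer.Base as ℤ using (ℤ; 0ℤ; 1ℤ)
open import Data.Integer.Properties using () renaming (_≟_ to _≟ᶻ_)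
open import Data.List.Base
  using (List; []; _∷_; [_]; _++_; length; filter; foldr; applyUpTo; cartesianProductWith)
open import Data.Nat.Base
  using (ℕ; suc; _+_; _*_; _<_; s≤s; z≤n; ⌊_/2⌋; ⌈_/2⌉)
open import Data.Nat.Divisibility using (_∣_; _∣?_; m∣m*n; ∣m+n∣m⇒∣n; ∣1⇒≡1)
open import Data.Nat.Induction using (Acc; acc; <-wellFounded)
open import Data.Nat.Properties
  using (⌊n/2⌋<n; ⌈n/2⌉<n; +-comm; m≤n⇒m≤o+n; +-identityʳ; n≡⌊n+n/2⌋; n≡⌈n+n/2⌉)
open import Data.Product.Base using (_×_; _,_; proj₁)
open import Relation.Binary.PropositionalEquality
  using (_≡_; refl; sym; trans; cong; cong₂; subst)
open import Relation.Nullary.Decidable using (does; dec-true; dec-false)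
open import Relation.Nullary.Negation using (¬_)

-- ℤ[t]: the list a₀ ∷ a₁ ∷ … stands for a₀ + a₁ t + ….  Trailing zeros are
-- allowed, so a polynomial has several representatives.

Poly : Set
Poly = List ℤ

infixl 6 _+ᴾ_
infixr 8 t·_

_+ᴾ_ : Poly → Poly → Poly
[]       +ᴾ q        = q
(a ∷ p)  +ᴾ []       = a ∷ p
(a ∷ p)  +ᴾ (b ∷ q)  = (a ℤ.+ b) ∷ (p +ᴾ q)

t·_ : Poly → Poly
t· p = 0ℤ ∷ p

-- For even n the two halves coincide; for n = 2k + 1 they are k and k + 1.

stern-acc : ∀ n → Acc _<_ n → Poly
stern-acc 0               _         = []
stern-acc 1               _         = [ 1ℤ ]
stern-acc n@(suc (suc m)) (acc rs)  =
  if does (2 ∣? n)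
  then t· stern-acc ⌊ n /2⌋ (rs (⌊n/2⌋<n (suc m)))
  else stern-acc ⌊ n /2⌋ (rs (⌊n/2⌋<n (suc m))) +ᴾ stern-acc ⌈ n /2⌉ (rs (⌈n/2⌉<n m))

B : ℕ → Poly
B n = stern-acc n (<-wellFounded n)

-- The defining recurrences B₂ₙ = t Bₙ and B₂ₙ₊₁ = Bₙ + Bₙ₊₁ for n ≥ 1.

private
  stern-irr : ∀ n (a b : Acc _<_ n) → stern-acc n a ≡ stern-acc n b
  stern-irr 0               _        _         = refl
  stern-irr 1               _        _         = refl
  stern-irr n@(suc (suc m)) (acc rs) (acc rs′) =
    cong₂ (λ p q → if does (2 ∣? n) then t· p else p +ᴾ q)
      (stern-irr ⌊ n /2⌋ (rs (⌊n/2⌋<n (suc m))) (rs′ (⌊n/2⌋<n (suc m))))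
      (stern-irr ⌈ n /2⌉ (rs (⌈n/2⌉<n m)) (rs′ (⌈n/2⌉<n m)))

  stern-step : ∀ m → let n = suc (suc m) in
    B n ≡ (if does (2 ∣? n) then t· B ⌊ n /2⌋ else B ⌊ n /2⌋ +ᴾ B ⌈ n /2⌉)
  stern-step m = cong₂ (λ p q → if does (2 ∣? n) then t· p else p +ᴾ q)
      (stern-irr ⌊ n /2⌋ _ (<-wellFounded ⌊ n /2⌋))
      (stern-irr ⌈ n /2⌉ _ (<-wellFounded ⌈ n /2⌉))
    where n = suc (suc m)

  double : ∀ n → 2 * n ≡ n + n
  double n = cong (n +_) (+-identityʳ n)

  odd : ∀ n → ¬ (2 ∣ suc (2 * n))
  odd n 2∣ with ∣1⇒≡1 (∣m+n∣m⇒∣n (subst (2 ∣_) (+-comm 1 (2 * n)) 2∣) (m∣m*n n))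
  ... | ()

  step-even : ∀ n → 1 < n → 2 ∣ n → B n ≡ t· B ⌊ n /2⌋
  step-even n@(suc (suc m)) (s≤s (s≤s _)) 2∣n = trans (stern-step m)
    (cong (λ b → if b then t· B ⌊ n /2⌋ else B ⌊ n /2⌋ +ᴾ B ⌈ n /2⌉) (dec-true (2 ∣? n) 2∣n))

  step-odd : ∀ n → 1 < n → ¬ (2 ∣ n) → B n ≡ B ⌊ n /2⌋ +ᴾ B ⌈ n /2⌉
  step-odd n@(suc (suc m)) (s≤s (s≤s _)) 2∤n = trans (stern-step m)
    (cong (λ b → if b then t· B ⌊ n /2⌋ else B ⌊ n /2⌋ +ᴾ B ⌈ n /2⌉) (dec-false (2 ∣? n) 2∤n))

  ⌊2n/2⌋ : ∀ n → ⌊ 2 * n /2⌋ ≡ n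
  ⌊2n/2⌋ n = trans (cong ⌊_/2⌋ (double n)) (sym (n≡⌊n+n/2⌋ n))

  ⌈2n/2⌉ : ∀ n → ⌈ 2 * n /2⌉ ≡ n
  ⌈2n/2⌉ n = trans (cong ⌈_/2⌉ (double n)) (sym (n≡⌈n+n/2⌉ n))

B-even : ∀ k → let n = suc k in B (2 * n) ≡ t· B n
B-even k = trans (step-even (2 * suc k) (s≤s (m≤n⇒m≤o+n k (s≤s z≤n))) (m∣m*n (suc k)))
  (cong (λ j → t· B j) (⌊2n/2⌋ (suc k)))

B-odd : ∀ k → let n = suc k in B (suc (2 * n)) ≡ B n +ᴾ B (suc n)
B-odd k = trans (step-odd (suc (2 * suc k)) (s≤s (s≤s z≤n)) (odd (suc k)))
  (cong₂ (λ i j → B i +ᴾ B j) (⌈2n/2⌉ (suc k)) (cong suc (⌊2n/2⌋ (suc k))))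

-- ℤ[t, t⁻¹]: the list (c₁ , e₁) ∷ (c₂ , e₂) ∷ … stands for
-- c₁ t^e₁ + c₂ t^e₂ + …, with exponents in any order and possibly repeated.
-- Laurent polynomials are equal when all their coefficients agree.

Laurent : Set
Laurent = List (ℤ × ℤ)

coeff : Laurent → ℤ → ℤ
coeff []            k = 0ℤ
coeff ((c , e) ∷ p) k = (if does (e ≟ᶻ k) then c else 0ℤ) ℤ.+ coeff p k

infix  4 _≈_
infixl 6 _+ᴸ_
infixl 7 _*ᴸ_
infix  9 t^_

_≈_ : Laurent → Laurent → Set
p ≈ q = ∀ k → coeff p k ≡ coeff q k

0ᴸ : Laurent
0ᴸ = []

const : ℤ → Laurent
const c = [ c , 0ℤ ]

t^_ : ℤ → Laurent
t^ e = [ 1ℤ , e ]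

_+ᴸ_ : Laurent → Laurent → Laurent
_+ᴸ_ = _++_

_*ᴸ_ : Laurent → Laurent → Laurent
_*ᴸ_ = cartesianProductWith λ { (c , e) (d , f) → c ℤ.* d , e ℤ.+ f }

∑≤ : ℕ → (ℕ → Laurent) → Laurent
∑≤ n f = foldr _+ᴸ_ 0ᴸ (applyUpTo f (suc n))

eval : Poly → Laurent → Laurent
eval []      x = 0ᴸ
eval (a ∷ p) x = const a +ᴸ x *ᴸ eval p x

ν : ℕ → ℕ
ν n = length (filter (_≟ᶠ 1b) (proj₁ (toDigits 2 n)))

{-# OPTIONS --safe #-}

-- Both sides satisfy the same recurrences.  Write S(n) for the sum and split it
-- according to the parity of i.  Since ν(2m) = ν(m) and ν(2m + 1) = ν(m) + 1,
--   S(2m + 1) = t S(m) + t⁻¹ S(m),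
-- and in S(2m) the even i contribute S(m) and the odd i contribute S(m − 1), the
-- two extra digits 1 cancelling in the exponent.  These are the recurrences of
-- B₂₍ₘ₊₁₎ and B₂ₘ₊₁.

module Submission where

open import Defs
open import Algebra.Properties.CommutativeSemigroup using (interchange)
open import Data.Bool.Base using (if_then_else_; true; false)
open import Data.Digit using (Bit; 0b; 1b; fromDigits; toDigits)
open import Data.Fin.Base using (zero; suc)
open import Data.Fin.Properties using () renaming (_≟_ to _≟ᶠ_)
open import Data.Integer.Base as ℤ using (ℤ)
open import Data.Integer.Base using (+_; _-_; 0ℤ; 1ℤ; -1ℤ)
open import Data.Integer.Properties as ℤₚ using () renaming (_≟_ to _≟ᶻ_)
open import Data.Integer.Tactic.RingSolver using (solve-∀)
open import Data.List.Base using (List; []; _∷_; [_]; _++_; length; filter; foldr; applyUpTo)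
open import Data.List.Properties using (++-identityʳ; cartesianProductWith-distribʳ-++)
open import Data.Nat.Base using (ℕ; suc; _∸_)
open import Data.Nat.Base using (_*_; _≤_; _<_; z≤n; s≤s; z<s; s<s; ⌊_/2⌋; ⌈_/2⌉)
open import Data.Nat.DivMod using (DivMod; result; _divMod_)
open import Data.Nat.Induction using (<-rec)
open import Data.Nat.Properties
  using (*-comm; *-cancelʳ-≡; *-distribʳ-∸; even≢odd; m≤m*n; m≤n⇒m≤1+n; suc-injective)
open import Data.Product.Base using (_,_; proj₁; proj₂)
open import Function.Base using (_∘_)
open import Relation.Binary.PropositionalEquality
  using (_≡_; _≢_; refl; sym; trans; cong; cong₂; module ≡-Reasoning)
open import Relation.Nullary.Decidable using (does; yes; no; dec-true; dec-false)
open import Relation.Nullary.Negation using (contradiction)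

-- Binary digits

ones : List Bit → ℕ
ones ds = length (filter (_≟ᶠ 1b) ds)

*2≢suc*2 : ∀ m n → m * 2 ≢ suc (n * 2)
*2≢suc*2 m n eq = even≢odd m n (trans (*-comm 2 m) (trans eq (cong suc (*-comm n 2))))

-- Parity fixes the least significant digit, and cancelling the factor 2 leaves the remaining
-- digits. Against `[]` every digit must be 0, so lists of equal value differ only in zeros at the
-- top. Hence `ν` can be read off any binary expansion, whichever one `toDigits` returns.
ones-unique : ∀ ds es → fromDigits ds ≡ fromDigits es → ones ds ≡ ones es
ones-unique []              []              eq = refl
ones-unique []              (zero ∷ es)     eq = ones-unique [] es (*-cancelʳ-≡ 0 _ 2 eq)
ones-unique (zero ∷ ds)     []              eq = ones-unique ds [] (*-cancelʳ-≡ _ 0 2 eq)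
ones-unique (zero ∷ ds)     (zero ∷ es)     eq = ones-unique ds es (*-cancelʳ-≡ _ _ 2 eq)
ones-unique (zero ∷ ds)     (suc zero ∷ es) eq =
  contradiction eq (*2≢suc*2 (fromDigits ds) (fromDigits es))
ones-unique (suc zero ∷ ds) (zero ∷ es)     eq =
  contradiction (sym eq) (*2≢suc*2 (fromDigits es) (fromDigits ds))
ones-unique (suc zero ∷ ds) (suc zero ∷ es) eq =
  cong suc (ones-unique ds es (*-cancelʳ-≡ _ _ 2 (suc-injective eq)))

ν-unique : ∀ {n} ds → fromDigits ds ≡ n → ν n ≡ ones ds
ν-unique {n} ds eq = ones-unique (proj₁ (toDigits 2 n)) ds (trans (proj₂ (toDigits 2 n)) (sym eq))

ν-double : ∀ n → ν (n * 2) ≡ ν n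
ν-double n = ν-unique {n * 2} (0b ∷ proj₁ (toDigits 2 n)) (cong (_* 2) (proj₂ (toDigits 2 n)))

ν-suc-double : ∀ n → ν (suc (n * 2)) ≡ suc (ν n)
ν-suc-double n =
  ν-unique {suc (n * 2)} (1b ∷ proj₁ (toDigits 2 n)) (cong (λ m → suc (m * 2)) (proj₂ (toDigits 2 n)))

-- Laurent polynomials

coeff-++ : ∀ p q k → coeff (p ++ q) k ≡ coeff p k ℤ.+ coeff q k
coeff-++ []            q k = sym (ℤₚ.+-identityˡ _)
coeff-++ ((c , e) ∷ p) q k =
  trans (cong (λ z → a ℤ.+ z) (coeff-++ p q k)) (sym (ℤₚ.+-assoc a _ _))
  where a = if does (e ≟ᶻ k) then c else 0ℤ

-- An entry `(d , f)` of `p` becomes `(c ℤ.* d , e ℤ.+ f)`, and `e ℤ.+ f` equals `k` exactly when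
-- `f` equals `k - e`.
coeff-[]* : ∀ c e p k → coeff ([ c , e ] *ᴸ p) k ≡ c ℤ.* coeff p (k - e)
coeff-[]* c e []            k = sym (ℤₚ.*-zeroʳ c)
coeff-[]* c e ((d , f) ∷ p) k =
  trans (cong₂ ℤ._+_ head (coeff-[]* c e p k)) (sym (ℤₚ.*-distribˡ-+ c _ _))
  where
  cancelˡ : ∀ e f → f ≡ (e ℤ.+ f) - e
  cancelˡ = solve-∀

  cancelʳ : ∀ e k → e ℤ.+ (k - e) ≡ k
  cancelʳ = solve-∀

  head : (if does (e ℤ.+ f ≟ᶻ k) then c ℤ.* d else 0ℤ) ≡
         c ℤ.* (if does (f ≟ᶻ k - e) then d else 0ℤ)
  head with e ℤ.+ f ≟ᶻ k
  ... | yes refl rewrite dec-true (f ≟ᶻ (e ℤ.+ f) - e) (cancelˡ e f) = refl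
  ... | no e+f≢k
    rewrite dec-false (f ≟ᶻ k - e) (λ f≡ → e+f≢k (trans (cong (λ z → e ℤ.+ z) f≡) (cancelʳ e k)))
    = sym (ℤₚ.*-zeroʳ c)

*ᴸ-distribʳ-+ᴸ : ∀ p x y → (x +ᴸ y) *ᴸ p ≡ x *ᴸ p +ᴸ y *ᴸ p
*ᴸ-distribʳ-+ᴸ p x y = cartesianProductWith-distribʳ-++ _ x y p

coeff-∷* : ∀ c e x p k →
  coeff (((c , e) ∷ x) *ᴸ p) k ≡ c ℤ.* coeff p (k - e) ℤ.+ coeff (x *ᴸ p) k
coeff-∷* c e x p k =
  trans (cong (λ q → coeff q k) (*ᴸ-distribʳ-+ᴸ p [ c , e ] x))
    (trans (coeff-++ ([ c , e ] *ᴸ p) (x *ᴸ p) k)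
      (cong (ℤ._+ coeff (x *ᴸ p) k) (coeff-[]* c e p k)))

-- Peeling monomials off `x` shows that a coefficient of the product depends on the right factor
-- only through its coefficients, not on the list representing it.
*ᴸ-congˡ : ∀ x p q → p ≈ q → x *ᴸ p ≈ x *ᴸ q
*ᴸ-congˡ []            p q p≈q k = refl
*ᴸ-congˡ ((c , e) ∷ x) p q p≈q k = begin
  coeff (((c , e) ∷ x) *ᴸ p) k                     ≡⟨ coeff-∷* c e x p k ⟩
  c ℤ.* coeff p (k - e) ℤ.+ coeff (x *ᴸ p) k       ≡⟨ cong₂ (λ a b → c ℤ.* a ℤ.+ b) (p≈q (k - e)) (*ᴸ-congˡ x p q p≈q k) ⟩
  c ℤ.* coeff q (k - e) ℤ.+ coeff (x *ᴸ q) k       ≡⟨ coeff-∷* c e x q k ⟨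
  coeff (((c , e) ∷ x) *ᴸ q) k                     ∎
  where open ≡-Reasoning

-- The product runs through the left factor first, so splitting the right factor permutes the
-- entries: the two lists agree only up to `_≈_`.
*ᴸ-distribˡ-+ᴸ : ∀ x p q → x *ᴸ (p +ᴸ q) ≈ x *ᴸ p +ᴸ x *ᴸ q
*ᴸ-distribˡ-+ᴸ []            p q k = refl
*ᴸ-distribˡ-+ᴸ ((c , e) ∷ x) p q k = begin
  coeff (((c , e) ∷ x) *ᴸ (p ++ q)) k
    ≡⟨ coeff-∷* c e x (p ++ q) k ⟩
  c ℤ.* coeff (p ++ q) (k - e) ℤ.+ coeff (x *ᴸ (p ++ q)) k
    ≡⟨ cong₂ (λ a b → c ℤ.* a ℤ.+ b) (coeff-++ p q (k - e))
         (trans (*ᴸ-distribˡ-+ᴸ x p q k) (coeff-++ (x *ᴸ p) (x *ᴸ q) k)) ⟩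
  c ℤ.* (coeff p (k - e) ℤ.+ coeff q (k - e)) ℤ.+ (coeff (x *ᴸ p) k ℤ.+ coeff (x *ᴸ q) k)
    ≡⟨ rearrange c _ _ _ _ ⟩
  (c ℤ.* coeff p (k - e) ℤ.+ coeff (x *ᴸ p) k) ℤ.+ (c ℤ.* coeff q (k - e) ℤ.+ coeff (x *ᴸ q) k)
    ≡⟨ cong₂ ℤ._+_ (coeff-∷* c e x p k) (coeff-∷* c e x q k) ⟨
  coeff (((c , e) ∷ x) *ᴸ p) k ℤ.+ coeff (((c , e) ∷ x) *ᴸ q) k
    ≡⟨ coeff-++ (((c , e) ∷ x) *ᴸ p) _ k ⟨
  coeff (((c , e) ∷ x) *ᴸ p ++ ((c , e) ∷ x) *ᴸ q) k ∎
  where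
  open ≡-Reasoning
  rearrange : ∀ c a b a′ b′ → c ℤ.* (a ℤ.+ b) ℤ.+ (a′ ℤ.+ b′) ≡ (c ℤ.* a ℤ.+ a′) ℤ.+ (c ℤ.* b ℤ.+ b′)
  rearrange = solve-∀

-- Evaluation of polynomials at a Laurent polynomial

coeff-const-0 : ∀ k → coeff (const 0ℤ) k ≡ 0ℤ
coeff-const-0 k with does (0ℤ ≟ᶻ k)
... | true  = refl
... | false = refl

coeff-const-+ : ∀ a b k → coeff (const (a ℤ.+ b)) k ≡ coeff (const a) k ℤ.+ coeff (const b) k
coeff-const-+ a b k with does (0ℤ ≟ᶻ k)
... | true  = rearrange a b
  where
  rearrange : ∀ a b → (a ℤ.+ b) ℤ.+ 0ℤ ≡ (a ℤ.+ 0ℤ) ℤ.+ (b ℤ.+ 0ℤ)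
  rearrange = solve-∀
... | false = refl

-- The constant coefficient of `t· p` leaves an explicit entry with coefficient 0 in the list, which
-- only `_≈_` ignores.
eval-t· : ∀ p x → eval (t· p) x ≈ x *ᴸ eval p x
eval-t· p x k = begin
  coeff (const 0ℤ ++ x *ᴸ eval p x) k                ≡⟨ coeff-++ (const 0ℤ) (x *ᴸ eval p x) k ⟩
  coeff (const 0ℤ) k ℤ.+ coeff (x *ᴸ eval p x) k     ≡⟨ cong (ℤ._+ coeff (x *ᴸ eval p x) k) (coeff-const-0 k) ⟩
  0ℤ ℤ.+ coeff (x *ᴸ eval p x) k                     ≡⟨ ℤₚ.+-identityˡ _ ⟩
  coeff (x *ᴸ eval p x) k                            ∎
  where open ≡-Reasoning

eval-+ᴾ : ∀ p q x → eval (p +ᴾ q) x ≈ eval p x +ᴸ eval q x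
eval-+ᴾ []      q       x k = refl
eval-+ᴾ (a ∷ p) []      x k = cong (λ r → coeff r k) (sym (++-identityʳ (eval (a ∷ p) x)))
eval-+ᴾ (a ∷ p) (b ∷ q) x k = begin
  coeff (const (a ℤ.+ b) ++ x *ᴸ eval (p +ᴾ q) x) k
    ≡⟨ coeff-++ (const (a ℤ.+ b)) (x *ᴸ eval (p +ᴾ q) x) k ⟩
  coeff (const (a ℤ.+ b)) k ℤ.+ coeff (x *ᴸ eval (p +ᴾ q) x) k
    ≡⟨ cong₂ ℤ._+_ (coeff-const-+ a b k)
         (trans (*ᴸ-congˡ x (eval (p +ᴾ q) x) (P ++ Q) (eval-+ᴾ p q x) k)
           (trans (*ᴸ-distribˡ-+ᴸ x P Q k) (coeff-++ (x *ᴸ P) (x *ᴸ Q) k))) ⟩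
  (coeff (const a) k ℤ.+ coeff (const b) k) ℤ.+ (coeff (x *ᴸ P) k ℤ.+ coeff (x *ᴸ Q) k)
    ≡⟨ interchange ℤₚ.+-commutativeSemigroup (coeff (const a) k) _ _ _ ⟩
  (coeff (const a) k ℤ.+ coeff (x *ᴸ P) k) ℤ.+ (coeff (const b) k ℤ.+ coeff (x *ᴸ Q) k)
    ≡⟨ cong₂ ℤ._+_ (coeff-++ (const a) (x *ᴸ P) k) (coeff-++ (const b) (x *ᴸ Q) k) ⟨
  coeff (eval (a ∷ p) x) k ℤ.+ coeff (eval (b ∷ q) x) k
    ≡⟨ coeff-++ (eval (a ∷ p) x) _ k ⟨
  coeff (eval (a ∷ p) x ++ eval (b ∷ q) x) k ∎
  where
  open ≡-Reasoning
  P = eval p x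
  Q = eval q x

-- Finite sums

-- The half-open range allows empty sums, as induction and the parity split require; `∑≤ n f`
-- unfolds to `∑< (suc n) f`.
∑< : ℕ → (ℕ → Laurent) → Laurent
∑< n f = foldr _+ᴸ_ 0ᴸ (applyUpTo f n)

∑<-cong : ∀ n {f g : ℕ → Laurent} → (∀ {j} → j < n → f j ≡ g j) → ∑< n f ≡ ∑< n g
∑<-cong 0       eq = refl
∑<-cong (suc n) eq = cong₂ _++_ (eq z<s) (∑<-cong n (eq ∘ s<s))

-- With a single monomial on the left no entries are permuted, so the lists are equal outright.
t^-*ᴸ-distribˡ-+ᴸ : ∀ e p q → t^ e *ᴸ (p +ᴸ q) ≡ t^ e *ᴸ p +ᴸ t^ e *ᴸ q
t^-*ᴸ-distribˡ-+ᴸ e []      q = refl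
t^-*ᴸ-distribˡ-+ᴸ e (_ ∷ p) q = cong (_ ∷_) (t^-*ᴸ-distribˡ-+ᴸ e p q)

t^-*ᴸ-∑< : ∀ e n f → t^ e *ᴸ ∑< n f ≡ ∑< n (λ j → t^ e *ᴸ f j)
t^-*ᴸ-∑< e 0       f = refl
t^-*ᴸ-∑< e (suc n) f = trans (t^-*ᴸ-distribˡ-+ᴸ e (f 0) _)
  (cong (t^ e *ᴸ f 0 ++_) (t^-*ᴸ-∑< e n (f ∘ suc)))

-- Removing the term at 0 shifts the index by one, so the even and odd positions of `f ∘ suc` are
-- the odd and even positions of `f`; floor and ceiling of the half swap likewise.
∑<-parity : ∀ n f →
  ∑< n f ≈ ∑< ⌈ n /2⌉ (λ j → f (j * 2)) +ᴸ ∑< ⌊ n /2⌋ (λ j → f (suc (j * 2)))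
∑<-parity 0       f k = refl
∑<-parity (suc n) f k = begin
  coeff (f 0 ++ ∑< n (f ∘ suc)) k
    ≡⟨ coeff-++ (f 0) _ k ⟩
  coeff (f 0) k ℤ.+ coeff (∑< n (f ∘ suc)) k
    ≡⟨ cong (λ z → coeff (f 0) k ℤ.+ z) (trans (∑<-parity n (f ∘ suc) k) (coeff-++ odds evens k)) ⟩
  coeff (f 0) k ℤ.+ (coeff odds k ℤ.+ coeff evens k)
    ≡⟨ rearrange (coeff (f 0) k) _ _ ⟩
  (coeff (f 0) k ℤ.+ coeff evens k) ℤ.+ coeff odds k
    ≡⟨ cong (ℤ._+ coeff odds k) (coeff-++ (f 0) evens k) ⟨
  coeff (f 0 ++ evens) k ℤ.+ coeff odds k
    ≡⟨ coeff-++ (f 0 ++ evens) odds k ⟨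
  coeff ((f 0 ++ evens) ++ odds) k ∎
  where
  open ≡-Reasoning
  odds  = ∑< ⌈ n /2⌉ (λ j → f (suc (j * 2)))
  evens = ∑< ⌊ n /2⌋ (λ j → f (suc (suc (j * 2))))
  rearrange : ∀ a b c → a ℤ.+ (b ℤ.+ c) ≡ (a ℤ.+ c) ℤ.+ b
  rearrange = solve-∀

⌊n*2/2⌋≡n : ∀ n → ⌊ n * 2 /2⌋ ≡ n
⌊n*2/2⌋≡n 0       = refl
⌊n*2/2⌋≡n (suc n) = cong suc (⌊n*2/2⌋≡n n)

⌈n*2/2⌉≡n : ∀ n → ⌈ n * 2 /2⌉ ≡ n
⌈n*2/2⌉≡n 0       = refl
⌈n*2/2⌉≡n (suc n) = cong suc (⌈n*2/2⌉≡n n)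

∑<-even : ∀ m f →
  ∑< (m * 2) f ≈ ∑< m (λ j → f (j * 2)) +ᴸ ∑< m (λ j → f (suc (j * 2)))
∑<-even m f k = trans (∑<-parity (m * 2) f k)
  (cong₂ (λ a b → coeff (∑< a (λ j → f (j * 2)) ++ ∑< b (λ j → f (suc (j * 2)))) k)
    (⌈n*2/2⌉≡n m) (⌊n*2/2⌋≡n m))

∑<-odd : ∀ m f →
  ∑< (suc (m * 2)) f ≈ ∑< (suc m) (λ j → f (j * 2)) +ᴸ ∑< m (λ j → f (suc (j * 2)))
∑<-odd m f k = trans (∑<-parity (suc (m * 2)) f k)
  (cong₂ (λ a b → coeff (∑< (suc a) (λ j → f (j * 2)) ++ ∑< b (λ j → f (suc (j * 2)))) k)
    -- The ceiling for `suc (m * 2)` unfolds to the successor of the floor for `m * 2`, and the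
    -- floor to the ceiling.
    (⌊n*2/2⌋≡n m) (⌈n*2/2⌉≡n m))

-- Recurrences of the sum

term : ℕ → ℕ → Laurent
term n i = t^ (+ ν (n ∸ i) - + ν i)

S : ℕ → Laurent
S n = ∑≤ n (term n)

ν-even∸even : ∀ m j → ν (m * 2 ∸ j * 2) ≡ ν (m ∸ j)
ν-even∸even m j = trans (cong ν (sym (*-distribʳ-∸ 2 m j))) (ν-double (m ∸ j))

-- The bound keeps the subtraction from truncating: for `j` above `m` the left side would be 0 and
-- the right side 1.
odd∸even : ∀ {m j} → j ≤ m → suc (m * 2) ∸ j * 2 ≡ suc ((m ∸ j) * 2)
odd∸even z≤n       = refl
odd∸even (s≤s j≤m) = odd∸even j≤m

ν-odd∸even : ∀ {m j} → j ≤ m → ν (suc (m * 2) ∸ j * 2) ≡ suc (ν (m ∸ j))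
ν-odd∸even {m} {j} j≤m = trans (cong ν (odd∸even j≤m)) (ν-suc-double (m ∸ j))

+suc-+ : ∀ a b → + suc a - + b ≡ 1ℤ ℤ.+ (+ a - + b)
+suc-+ a b = ℤₚ.+-assoc 1ℤ (+ a) (ℤ.- + b)

+-+suc : ∀ a b → + a - + suc b ≡ -1ℤ ℤ.+ (+ a - + b)
+-+suc a b = lemma (+ a) (+ b)
  where
  lemma : ∀ a b → a - (1ℤ ℤ.+ b) ≡ -1ℤ ℤ.+ (a - b)
  lemma = solve-∀

+suc-+suc : ∀ a b → + suc a - + suc b ≡ + a - + b
+suc-+suc a b = lemma (+ a) (+ b)
  where
  lemma : ∀ a b → (1ℤ ℤ.+ a) - (1ℤ ℤ.+ b) ≡ a - b
  lemma = solve-∀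

t^-cong : ∀ {a b a′ b′} → a ≡ a′ → b ≡ b′ → t^ (+ a - + b) ≡ t^ (+ a′ - + b′)
t^-cong = cong₂ (λ a b → t^ (+ a - + b))

-- With n = 2m + 1, the index i = 2j gives n - i the extra digit 1, hence a factor t; i = 2j + 1
-- carries the extra digit itself, hence t⁻¹.
S-odd : ∀ m → S (suc (m * 2)) ≈ (t^ 1ℤ +ᴸ t^ -1ℤ) *ᴸ S m
S-odd m k = begin
  coeff (S (suc (m * 2))) k
    -- The sum runs from 0 to 2m + 1, so it has 2(m + 1) terms.
    ≡⟨ ∑<-even (suc m) (term (suc (m * 2))) k ⟩
  coeff (∑< (suc m) (λ j → term (suc (m * 2)) (j * 2)) ++
         ∑< (suc m) (λ j → term (suc (m * 2)) (suc (j * 2)))) k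
    ≡⟨ cong₂ (λ p q → coeff (p ++ q) k) (∑<-cong (suc m) evens) (∑<-cong (suc m) odds) ⟩
  coeff (∑< (suc m) (λ j → t^ 1ℤ *ᴸ term m j) ++ ∑< (suc m) (λ j → t^ -1ℤ *ᴸ term m j)) k
    ≡⟨ cong₂ (λ p q → coeff (p ++ q) k) (t^-*ᴸ-∑< 1ℤ (suc m) (term m)) (t^-*ᴸ-∑< -1ℤ (suc m) (term m)) ⟨
  coeff (t^ 1ℤ *ᴸ S m ++ t^ -1ℤ *ᴸ S m) k
    ≡⟨ cong (λ p → coeff p k) (*ᴸ-distribʳ-+ᴸ (S m) (t^ 1ℤ) (t^ -1ℤ)) ⟨
  coeff ((t^ 1ℤ +ᴸ t^ -1ℤ) *ᴸ S m) k ∎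
  where
  open ≡-Reasoning
  evens : ∀ {j} → j < suc m → term (suc (m * 2)) (j * 2) ≡ t^ 1ℤ *ᴸ term m j
  evens {j} (s≤s j≤m) = trans (t^-cong (ν-odd∸even j≤m) (ν-double j))
    (cong t^_ (+suc-+ (ν (m ∸ j)) (ν j)))

  odds : ∀ {j} → j < suc m → term (suc (m * 2)) (suc (j * 2)) ≡ t^ -1ℤ *ᴸ term m j
  odds {j} _ = trans (t^-cong (ν-even∸even m j) (ν-suc-double j))
    (cong t^_ (+-+suc (ν (m ∸ j)) (ν j)))

-- Indexing by m + 1 avoids a predecessor. For i = 2j + 1 both i and 2(m + 1) - i = 2(m - j) + 1
-- gain a digit 1, and these cancel in the exponent.
S-even : ∀ m → S (suc m * 2) ≈ S (suc m) +ᴸ S m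
S-even m k = trans (∑<-odd (suc m) (term (suc m * 2)) k)
  (cong₂ (λ p q → coeff (p ++ q) k) (∑<-cong (suc (suc m)) evens) (∑<-cong (suc m) odds))
  where
  evens : ∀ {j} → j < suc (suc m) → term (suc m * 2) (j * 2) ≡ term (suc m) j
  evens {j} _ = t^-cong (ν-even∸even (suc m) j) (ν-double j)

  odds : ∀ {j} → j < suc m → term (suc m * 2) (suc (j * 2)) ≡ term m j
  odds {j} (s≤s j≤m) = trans (t^-cong (ν-odd∸even j≤m) (ν-suc-double j))
    (cong t^_ (+suc-+suc (ν (m ∸ j)) (ν j)))

-- Strong induction on the index

theorem3p7 : (n : ℕ) →
    eval (B (suc n)) (t^ 1ℤ +ᴸ t^ -1ℤ) ≈ ∑≤ n (λ i → t^ (+ ν (n ∸ i) - + ν i))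
theorem3p7 = <-rec P λ n → by-parity n (n divMod 2)
  where
  open ≡-Reasoning
  x = t^ 1ℤ +ᴸ t^ -1ℤ

  P : ℕ → Set
  P n = eval (B (suc n)) x ≈ S n

  odd-step : ∀ m → P m → P (suc (m * 2))
  odd-step m ih k = begin
    coeff (eval (B (suc m * 2)) x) k
      -- The polynomial has index n + 1 = 2(m + 1), so odd n meets the even recurrence.
      ≡⟨ cong (λ p → coeff (eval p x) k) (trans (cong B (*-comm (suc m) 2)) (B-even m)) ⟩
    coeff (eval (t· B (suc m)) x) k        ≡⟨ eval-t· (B (suc m)) x k ⟩
    coeff (x *ᴸ eval (B (suc m)) x) k      ≡⟨ *ᴸ-congˡ x (eval (B (suc m)) x) (S m) ih k ⟩
    coeff (x *ᴸ S m) k                     ≡⟨ S-odd m k ⟨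
    coeff (S (suc (m * 2))) k              ∎

  even-step : ∀ m → P m → P (suc m) → P (suc m * 2)
  even-step m ih ih′ k = begin
    coeff (eval (B (suc (suc m * 2))) x) k
      ≡⟨ cong (λ p → coeff (eval p x) k) (trans (cong (B ∘ suc) (*-comm (suc m) 2)) (B-odd m)) ⟩
    coeff (eval (b +ᴾ b′) x) k                   ≡⟨ eval-+ᴾ b b′ x k ⟩
    coeff (eval b x ++ eval b′ x) k              ≡⟨ coeff-++ (eval b x) (eval b′ x) k ⟩
    coeff (eval b x) k ℤ.+ coeff (eval b′ x) k   ≡⟨ cong₂ ℤ._+_ (ih k) (ih′ k) ⟩
    coeff (S m) k ℤ.+ coeff (S (suc m)) k        ≡⟨ ℤₚ.+-comm (coeff (S m) k) _ ⟩
    coeff (S (suc m)) k ℤ.+ coeff (S m) k        ≡⟨ coeff-++ (S (suc m)) (S m) k ⟨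
    coeff (S (suc m) ++ S m) k                   ≡⟨ S-even m k ⟨
    coeff (S (suc m * 2)) k                      ∎
    where
    b  = B (suc m)
    b′ = B (suc (suc m))

  base : P 0
  -- Both sides compute to the one-entry list for the constant 1.
  base k = refl

  by-parity : ∀ n → DivMod n 2 → (∀ {m} → m < n → P m) → P n
  -- Zero is split off from the even case: there the relation would read B₁ = B₀ + B₁ and call on
  -- `P 0` itself.
  by-parity n (result 0       zero       refl) rec = base
  by-parity n (result (suc m) zero       refl) rec = even-step m
    (rec {m} (s≤s (m≤n⇒m≤1+n (m≤m*n m 2)))) (rec {suc m} (s≤s (s≤s (m≤m*n m 2))))
  by-parity n (result m       (suc zero) refl) rec = odd-step m (rec {m} (s≤s (m≤m*n m 2)))
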